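{- For all integers $n\ge 36$ and $k$ with $\frac{n}{6}-2\ge k\ge 4$, there exists a feasible simple heterogeneous PV graph $\vec G_R$ with $n$ sites and $k$ carriers such that $$\mathcal M(\vec G_R)\ \ge\ \tfrac1{16}(k-3)(n^2-2n)^2.$$ This holds even if the agent knows $\vec G_R$ and $k$ and has unlimited memory.
   Context: A PV system consists of a finite set $S$ of $n$ sites and a set $C$ of $k\le n$ carriers; each carrier $c$ has a unique identifier and a route $\pi(c)=\langle x_0,\dots,x_{p(c)-1}\rangle$ of sites, with period $p(c)$ and $\pi(c)[j]=x_{j\bmod p(c)}$; at each time $t=0,1,\dots$ carrier $c$ moves from $\pi(c)[t]$ to $\pi(c)[t+1]$. The PV graph $\vec G_R$ is the directed edge-labelled multigraph on $S$ with edges $\bigcup_c\{(x_i,x_{i+1},i)\}$ (indices mod $p(c)$). It is homogeneous if all periods are equal, heterogeneous otherwise. A route is simple if $x_i\neq x_{i+1}$ for all $i$ and $(x_i,x_{i+1})=(x_j,x_{j+1})$ implies $i=j$ (indices mod $p(c)$); the PV graph is simple if every route is simple. An exploring agent is placed at time $0$ at a starting site $x\in\{\pi(c)[0]:c\in C\}$; at each time $t$, being at site $y$, it either halts or chooses a carrier $c$ with $\pi(c)[t]=y$ and moves with it to $\pi(c)[t+1]$ (one move). $\vec G_R$ is feasible if from every starting site there is a finite sequence of such moves visiting all sites. $\mathcal M(\vec G_R)$ is the minimum, over all agent strategies (which may use complete knowledge of $\vec G_R$ and unlimited memory) that from every starting site visit all sites and halt, of the maximum over starting sites of the number of moves made.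 -}

module Defs where

open import Data.Nat using (ℕ; zero; suc; _+_; _*_; _∸_; _<_; _≤_; NonZero; >-nonZero)
open import Data.Nat.DivMod using (_%_; m%n<n)
open import Data.Fin using (Fin; fromℕ<)
open import Data.List using (List; []; _∷_)
open import Data.List.Membership.Propositional using (_∈_)
open import Data.Product using (Σ; ∃; _×_; _,_)
open import Data.Unit using (⊤)
open import Relation.Binary.PropositionalEquality using (_≡_; _≢_)
open import Relation.Nullary using (¬_)

-- A PV system with n sites (Fin n) and k carriers (Fin k; the index is the
-- carrier's unique identifier).  Carrier c has period  period c ≥ 1  and route
-- route c : Fin (period c) → Fin n,  i.e. ⟨x_0, …, x_{p(c)-1}⟩.
record PV (n k : ℕ) : Set where
  field
    period   : Fin k → ℕ
    period>0 : (c : Fin k) → 0 < period c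
    route    : (c : Fin k) → Fin (period c) → Fin n

module _ {n k : ℕ} (G : PV n k) where
  open PV G

  π : (c : Fin k) → ℕ → Fin n
  π c j = route c (fromℕ< (m%n<n j (period c) {{>-nonZero (period>0 c)}}))

  Heterogeneous : Set
  Heterogeneous = Σ (Fin k) λ c → Σ (Fin k) λ c' → period c ≢ period c'

  SimpleRoute : Fin k → Set
  SimpleRoute c =
    ((i : ℕ) → π c i ≢ π c (suc i)) ×
    ((i j : ℕ) → i < period c → j < period c →
       π c i ≡ π c j → π c (suc i) ≡ π c (suc j) → i ≡ j)

  Simple : Set
  Simple = (c : Fin k) → SimpleRoute c

  IsStart : Fin n → Set
  IsStart x = ∃ λ c → π c 0 ≡ x

  -- A finite sequence of moves (carriers chosen at times t, t+1, …) made by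
  -- an agent that is at site y at time t, after which it halts.
  -- Valid: each chosen carrier is at the agent's current site at that time.
  ValidMoves : Fin n → ℕ → List (Fin k) → Set
  ValidMoves y t []       = ⊤
  ValidMoves y t (c ∷ cs) = (π c t ≡ y) × ValidMoves (π c (suc t)) (suc t) cs

  visited : Fin n → ℕ → List (Fin k) → List (Fin n)
  visited y t []       = y ∷ []
  visited y t (c ∷ cs) = y ∷ visited (π c (suc t)) (suc t) cs

  Explores : Fin n → List (Fin k) → Set
  Explores x cs = ValidMoves x 0 cs × ((s : Fin n) → s ∈ visited x 0 cs)

  Feasible : Set
  Feasible = (x : Fin n) → IsStart x → ∃ λ cs → Explores x cs

  -- An exploration strategy (full knowledge, unlimited memory): for every
  -- starting site, a finite sequence of moves that visits all sites and halts.
  Strategy : Set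
  Strategy = (x : Fin n) → IsStart x → List (Fin k)

  ExploringStrategy : Strategy → Set
  ExploringStrategy σ = (x : Fin n) (h : IsStart x) → Explores x (σ x h)

  -- M(G) ≥ a / d  (d > 0): every exploring strategy makes at least a/d
  -- moves from some starting site, i.e. a ≤ d * (#moves); equivalently the
  -- minimum over strategies of the worst-case number of moves is ≥ a/d.
  M≥ : (a d : ℕ) → Set
  M≥ a d = (σ : Strategy) → ExploringStrategy σ →
         ∃ λ x → Σ (IsStart x) λ h → a ≤ d * Data.List.length (σ x h)

{-# OPTIONS --safe #-}
module Submission where

-- Carriers 0, …, k − 1 form a chain in which only consecutive ones ever meet, once every P steps.
-- Their periods alternate between 2U and 2(U − 1), whose least common multiple is P = 2U(U − 1).
-- The ordinary sites split into two areas with U = |X| |Y|; at even times even carriers are in X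
-- and odd carriers in Y, at odd times conversely, so carriers of different parity can only collide
-- at dedicated meeting sites, and those of equal parity follow rotated copies of one route.
-- Carriers j − 1 and j meet at times ≡ − d(j) mod P with d increasing: having just boarded
-- carrier j, the agent has just missed carrier j + 1 and waits almost P steps. The parity of d(j)
-- alternates, so one meeting site serves two consecutive meetings; only k/2 + 1 sites are lost to
-- meetings, and U stays large enough for 16 P ≥ n⁴. The last meeting site lies only on the routes
-- of the last two carriers, so reaching it takes about (k − 2) P steps.

open import Defs
open import Data.Nat using (ℕ; _+_; _*_; _∸_; _^_; _≤_)
open import Data.Nat using (zero; suc; pred; _<_; z≤n; s≤s; s≤s⁻¹; NonZero; >-nonZero; ⌊_/2⌋; ⌈_/2⌉; parity)
open import Data.Nat.Properties
open import Data.Nat.DivMod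
open import Data.Nat.Divisibility
open import Data.Nat.Tactic.RingSolver using (solve-∀)
open import Data.Fin using (Fin; toℕ; fromℕ<; _↑ˡ_; _↑ʳ_; splitAt)
open import Data.Fin.Properties using (toℕ<n; toℕ-fromℕ<; toℕ-injective; splitAt-↑ˡ; splitAt-↑ʳ; splitAt⁻¹-↑ˡ; splitAt⁻¹-↑ʳ)
open import Data.List using (List; []; _∷_; length; allFin)
open import Data.List.Membership.Propositional using (_∈_)
open import Data.List.Membership.Propositional.Properties using (∈-allFin)
open import Data.List.Relation.Binary.Subset.Propositional using (_⊆_)
open import Data.List.Relation.Unary.Any using (here; there)
open import Data.Parity.Base as ℙ using (Parity; 0ℙ; 1ℙ; _⁻¹)
open import Data.Parity.Properties as ℙ using (p≢p⁻¹; ⁻¹-injective; suc-homo-⁻¹; +-homo-+; *-homo-*)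
open import Data.Product using (Σ; ∃; _×_; _,_; proj₁; proj₂)
open import Data.Sum using (_⊎_; inj₁; inj₂)
open import Data.Unit using (tt)
open import Function using (_∘_; id)
open import Relation.Binary.PropositionalEquality using (_≡_; _≢_; refl; sym; trans; cong; cong₂; subst; module ≡-Reasoning)
open import Relation.Nullary using (¬_; yes; no; contradiction)

-- Parity and halving of natural numbers.

parity-suc : ∀ n → parity (suc n) ≡ parity n ⁻¹
parity-suc n = trans (sym (ℙ.⁻¹-involutive (parity (suc n)))) (cong _⁻¹ (suc-homo-⁻¹ n))

2∣⇒parity≡0 : ∀ {n} → 2 ∣ n → parity n ≡ 0ℙ
2∣⇒parity≡0 (divides q refl) = go q
  where
  go : ∀ q → parity (q * 2) ≡ 0ℙ
  go zero    = refl
  go (suc q) = go q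

2∣+⇒parity≡ : ∀ m {n} → 2 ∣ m + n → parity m ≡ parity n
2∣+⇒parity≡ m {n} 2∣m+n = self-inverse (parity m) (parity n) (trans (sym (+-homo-+ m n)) (2∣⇒parity≡0 2∣m+n))
  where
  self-inverse : ∀ p q → p ℙ.+ q ≡ 0ℙ → p ≡ q
  self-inverse 0ℙ 0ℙ _ = refl
  self-inverse 1ℙ 1ℙ _ = refl

parity-half-injective : ∀ m n → parity m ≡ parity n → ⌊ m /2⌋ ≡ ⌊ n /2⌋ → m ≡ n
parity-half-injective 0 0 _ _ = refl
parity-half-injective 1 1 _ _ = refl
parity-half-injective (suc (suc m)) (suc (suc n)) p h =
  cong (suc ∘ suc) (parity-half-injective m n p (suc-injective h))
parity-half-injective 0 1 ()
parity-half-injective 0 (suc (suc n)) _ ()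
parity-half-injective 1 0 ()
parity-half-injective 1 (suc (suc n)) _ ()
parity-half-injective (suc (suc m)) 0 _ ()
parity-half-injective (suc (suc m)) 1 _ ()

half-suc-even : ∀ n → parity n ≡ 0ℙ → ⌊ suc n /2⌋ ≡ ⌊ n /2⌋
half-suc-even 0 _ = refl
half-suc-even (suc (suc n)) p = cong suc (half-suc-even n p)

half-suc-odd : ∀ n → parity n ≡ 1ℙ → ⌊ suc n /2⌋ ≡ suc ⌊ n /2⌋
half-suc-odd 1 _ = refl
half-suc-odd (suc (suc n)) p = cong suc (half-suc-odd n p)

parity-2* : ∀ n → parity (2 * n) ≡ 0ℙ
parity-2* n = *-homo-* 2 n

half-2* : ∀ n → ⌊ 2 * n /2⌋ ≡ n
half-2* n = trans (cong (λ m → ⌊ n + m /2⌋) (+-identityʳ n)) (sym (n≡⌊n+n/2⌋ n))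

2*half≤ : ∀ n → 2 * ⌊ n /2⌋ ≤ n
2*half≤ 0 = z≤n
2*half≤ 1 = z≤n
2*half≤ (suc (suc n)) = subst (_≤ suc (suc n)) (sym (*-suc 2 ⌊ n /2⌋)) (s≤s (s≤s (2*half≤ n)))

half<⇒ : ∀ {m n} → m < 2 * n → ⌊ m /2⌋ < n
half<⇒ {m} {n} m<2n = *-cancelˡ-< 2 _ _ (≤-<-trans (2*half≤ m) m<2n)

-- Residues, and divisibility of shifted times.

%-+-cancelˡ : ∀ q {m n} o .{{_ : NonZero o}} → (q + m) % o ≡ (q + n) % o → m % o ≡ n % o
%-+-cancelˡ q {m} {n} o eq = trans (sym (reduce m)) (trans (cong (λ r → (q * pred o + r) % o) eq) (reduce n))
  where
  -- Modulo `o`, adding `q * pred o` undoes adding `q`: together they add `q * o`.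
  reduce : ∀ x → (q * pred o + (q + x) % o) % o ≡ x % o
  reduce x = begin
    (q * pred o + (q + x) % o) % o           ≡⟨ %-distribˡ-+ (q * pred o) ((q + x) % o) o ⟩
    (q * pred o % o + (q + x) % o % o) % o   ≡⟨ cong (λ r → (q * pred o % o + r) % o) (m%n%n≡m%n (q + x) o) ⟩
    (q * pred o % o + (q + x) % o) % o       ≡⟨ %-distribˡ-+ (q * pred o) (q + x) o ⟨
    (q * pred o + (q + x)) % o               ≡⟨ cong (_% o) (trans (sym (+-assoc (q * pred o) q x)) (cong (_+ x) (trans (+-comm (q * pred o) q) (sym (*-suc q (pred o)))))) ⟩
    (q * suc (pred o) + x) % o               ≡⟨ cong (λ r → (q * r + x) % o) (suc-pred o) ⟩
    (q * o + x) % o                          ≡⟨ %-remove-+ˡ x (n∣m*n q) ⟩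
    x % o                                    ∎
    where open ≡-Reasoning

%-+-cancelʳ : ∀ q {m n} o .{{_ : NonZero o}} → (m + q) % o ≡ (n + q) % o → m % o ≡ n % o
%-+-cancelʳ q {m} {n} o eq = %-+-cancelˡ q o (trans (cong (_% o) (+-comm q m)) (trans eq (cong (_% o) (+-comm n q))))

%-<-injective : ∀ {m n o} .{{_ : NonZero o}} → m < o → n < o → m % o ≡ n % o → m ≡ n
%-<-injective m<o n<o eq = trans (sym (m<n⇒m%n≡m m<o)) (trans eq (m<n⇒m%n≡m n<o))

divMod-injective : ∀ m n o .{{_ : NonZero o}} → m % o ≡ n % o → m / o ≡ n / o → m ≡ n
divMod-injective m n o r q = begin
  m                    ≡⟨ m≡m%n+[m/n]*n m o ⟩
  m % o + (m / o) * o  ≡⟨ cong₂ (λ x y → x + y * o) r q ⟩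
  n % o + (n / o) * o  ≡⟨ m≡m%n+[m/n]*n n o ⟨
  n                    ∎
  where open ≡-Reasoning

∣-%+⇒∣-+ : ∀ p .{{_ : NonZero p}} t x → p ∣ t % p + x → p ∣ t + x
∣-%+⇒∣-+ p t x p∣ = subst (p ∣_) eq (∣m∣n⇒∣m+n p∣ (n∣m*n (t / p)))
  where
  eq : t % p + x + t / p * p ≡ t + x
  eq = trans (trans (+-assoc (t % p) x _) (cong (t % p +_) (+-comm x _)))
             (trans (sym (+-assoc (t % p) _ x)) (cong (_+ x) (sym (m≡m%n+[m/n]*n t p))))

∣-+⇒∣-%+ : ∀ p .{{_ : NonZero p}} t x → p ∣ t + x → p ∣ t % p + x
∣-+⇒∣-%+ p t x p∣ = ∣m+n∣m⇒∣n (subst (p ∣_) eq p∣) (n∣m*n (t / p))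
  where
  eq : t + x ≡ t / p * p + (t % p + x)
  eq = trans (cong (_+ x) (trans (m≡m%n+[m/n]*n t p) (+-comm (t % p) _))) (+-assoc _ (t % p) x)

-- m divides q (m + 1), hence q.
consecutive-∣ : ∀ m {x} → 2 * suc m ∣ x → 2 * m ∣ x → 2 * (suc m * m) ∣ x
consecutive-∣ m {x} (divides q x≡) 2m∣x = subst (2 * (suc m * m) ∣_) (trans (outward q m) (sym x≡))
  (*-monoʳ-∣ 2 (*-monoʳ-∣ (suc m) m∣q))
  where
  outward : ∀ q m → 2 * (suc m * q) ≡ q * (2 * suc m)
  outward = solve-∀
  inward : ∀ q m → q * (2 * suc m) ≡ 2 * (q * m + q)
  inward = solve-∀
  m∣q : m ∣ q
  m∣q = ∣m+n∣m⇒∣n (*-cancelˡ-∣ 2 (subst (2 * m ∣_) (trans x≡ (inward q m)) 2m∣x)) (n∣m*n q)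

∣-difference : ∀ {p} i e x → p ∣ i + x → p ∣ i + e + x → p ∣ e
∣-difference {p} i e x p∣i+x p∣i+e+x = ∣m+n∣m⇒∣n (subst (p ∣_) (swap i e x) p∣i+e+x) p∣i+x
  where
  swap : ∀ i e x → i + e + x ≡ i + x + e
  swap = solve-∀

∣-shift-unique-≤ : ∀ {p i j} x → i ≤ j → p ∣ i + x → p ∣ j + x → j < p → i ≡ j
∣-shift-unique-≤ {p} {i} x i≤j p∣i p∣j j<p with m≤n⇒∃[o]m+o≡n i≤j
... | zero  , refl = sym (+-identityʳ i)
... | suc e , refl = contradiction (∣⇒≤ (∣-difference i (suc e) x p∣i p∣j)) (<⇒≱ (≤-<-trans (m≤n+m (suc e) i) j<p))

∣-shift-unique : ∀ {p i j} x → p ∣ i + x → p ∣ j + x → i < p → j < p → i ≡ j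
∣-shift-unique {p} {i} {j} x p∣i p∣j i<p j<p with ≤-total i j
... | inj₁ i≤j = ∣-shift-unique-≤ x i≤j p∣i p∣j j<p
... | inj₂ j≤i = sym (∣-shift-unique-≤ x j≤i p∣j p∣i i<p)

-- Walks in an arbitrary PV graph: feasibility from recurrent meetings.

module Exploration {n k : ℕ} (G : PV n k) where

  -- Continuation-passing form: every walk from (z , t′) extends backwards to one from (y , t).
  Reach : Fin n → ℕ → Fin n → ℕ → Set
  Reach y t z t′ = ∀ cs → ValidMoves G z t′ cs →
    ∃ λ cs′ → ValidMoves G y t cs′ × visited G z t′ cs ⊆ visited G y t cs′

  reach-trans : ∀ {y t z t′ w t″} → Reach y t z t′ → Reach z t′ w t″ → Reach y t w t″
  reach-trans f g cs v with g cs v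
  ... | cs′ , v′ , s′ with f cs′ v′
  ... | cs″ , v″ , s″ = cs″ , v″ , s″ ∘ s′

  reach-refl : ∀ {y t} → Reach y t y t
  reach-refl cs v = cs , v , id

  ride : ∀ c t r → Reach (π G c t) t (π G c (r + t)) (r + t)
  ride c t zero    = reach-refl
  ride c t (suc r) = reach-trans (ride c t r) λ cs v → c ∷ cs , (refl , v) , there

  ride-until : ∀ c {t t′} → t ≤ t′ → Reach (π G c t) t (π G c t′) t′
  ride-until c {t} {t′} t≤t′ = subst (λ u → Reach (π G c t) t (π G c u) u) (m∸n+n≡m t≤t′) (ride c t (t′ ∸ t))

  Infinitely : (ℕ → Set) → Set
  Infinitely A = ∀ t → ∃ λ t′ → t ≤ t′ × A t′

  -- The agent's state is taken to be a carrier rather than a site, because waiting means riding on;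
  -- quantifying over every `t` is what lets connections be chained.
  Connected : Fin k → Fin k → Set
  Connected c c′ = ∀ t → ∃ λ t′ → Reach (π G c t) t (π G c′ t′) t′

  connected-trans : ∀ {c c′ c″} → Connected c c′ → Connected c′ c″ → Connected c c″
  connected-trans f g t with f t
  ... | t′ , r with g t′
  ... | t″ , r′ = t″ , reach-trans r r′

  meets⇒connected : ∀ {c c′} → Infinitely (λ t → π G c t ≡ π G c′ t) → Connected c c′
  meets⇒connected {c} meets t with meets t
  ... | t′ , t≤t′ , eq = t′ , subst (λ z → Reach (π G c t) t z t′) eq (ride-until c t≤t′)

  module _ (meet-next : ∀ c c′ → toℕ c′ ≡ suc (toℕ c) → Infinitely (λ t → π G c t ≡ π G c′ t)) where

    below : ∀ {i} (c : Fin k) → toℕ c ≡ suc i → ∃ λ (c′ : Fin k) → toℕ c′ ≡ i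
    below {i} c eq = fromℕ< i<k , toℕ-fromℕ< i<k
      where
      i<k : i < k
      i<k = <-trans (subst (i <_) (sym eq) (n<1+n i)) (toℕ<n c)

    -- Both directions through carrier 0 are built at once, so arbitrary pairs need no comparison of
    -- their positions in the chain.
    connected-first : ∀ i {c o : Fin k} → toℕ c ≡ i → toℕ o ≡ 0 → Connected c o × Connected o c
    connected-first zero {c} {o} c≡0 o≡0 with toℕ-injective (trans c≡0 (sym o≡0))
    ... | refl = (λ t → t , reach-refl) , (λ t → t , reach-refl)
    connected-first (suc i) {c} {o} c≡ o≡0 with below c c≡
    ... | c′ , refl with connected-first i {c′} {o} refl o≡0
    ... | down , up =
      connected-trans (meets⇒connected λ t → let (t′ , ≤t′ , eq) = meet-next c′ c c≡ t in t′ , ≤t′ , sym eq) down ,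
      connected-trans up (meets⇒connected (meet-next c′ c c≡))

    connected : ∀ c c′ → Connected c c′
    connected c c′ = connected-trans (proj₁ (connected-first _ {c} refl first≡0)) (proj₂ (connected-first _ {c′} refl first≡0))
      where
      0<k : 0 < k
      0<k = ≤-<-trans z≤n (toℕ<n c)
      first≡0 : toℕ (fromℕ< 0<k) ≡ 0
      first≡0 = toℕ-fromℕ< 0<k

  -- Induction on the sites still to be seen: change to a carrier that keeps returning to the next
  -- one, ride until it gets there, and continue from that carrier.
  tour : (∀ c c′ → Connected c c′) → (∀ s → ∃ λ c → Infinitely (λ t → π G c t ≡ s)) →
         ∀ (ss : List (Fin n)) c t → ∃ λ cs → ValidMoves G (π G c t) t cs × ss ⊆ visited G (π G c t) t cs
  tour conn visits []       c t = [] , tt , λ ()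
  tour conn visits (s ∷ ss) c t with visits s
  ... | c′ , late with conn c c′ t
  ... | t′ , r with late t′
  ... | t″ , t′≤t″ , refl with tour conn visits ss c′ t″
  ... | cs , v , ss⊆ with reach-trans r (ride-until c′ t′≤t″) cs v
  ... | cs′ , v′ , ⊆cs′ = cs′ , v′ , λ { (here refl) → ⊆cs′ (start cs) ; (there s∈) → ⊆cs′ (ss⊆ s∈) }
    where
    start : ∀ {y t} cs → y ∈ visited G y t cs
    start []      = here refl
    start (_ ∷ _) = here refl

  feasible : (∀ c c′ → toℕ c′ ≡ suc (toℕ c) → Infinitely (λ t → π G c t ≡ π G c′ t)) →
             (∀ s → ∃ λ c → Infinitely (λ t → π G c t ≡ s)) → Feasible G
  feasible meet-next visits x (c , refl) with tour (connected meet-next) visits (allFin n) c 0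
  ... | cs , v , all = cs , v , λ s → all (∈-allFin s)

  -- Lower bound on travel time along a chain of carriers.

  module _ (P : ℕ) (d : ℕ → ℕ) (d< : ∀ i → d i < d (suc i)) (d≤ : ∀ i → d (suc i) ≤ P + d i)
           (collide : ∀ c c′ t → π G c t ≡ π G c′ t →
              c ≡ c′ ⊎ (toℕ c′ ≡ suc (toℕ c) × P ∣ t + d (toℕ c′)) ⊎ (toℕ c ≡ suc (toℕ c′) × P ∣ t + d (toℕ c))) where

    -- The invariant of a walk that starts on carrier 0: carrier i is not reached before time iP - d
    -- i. The additive form avoids truncated subtraction.
    Earliest : ℕ → ℕ → Set
    Earliest i t = i * P ≤ t + d i

    -- Climbing is slow: at time t ≥ iP − d i, the next multiple of P of the form t + d (i + 1) is (i + 1) P.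
    earliest-up : ∀ {i t} → P ∣ t + d (suc i) → Earliest i t → Earliest (suc i) t
    earliest-up {i} {t} (divides q eq) e = subst (suc i * P ≤_) (sym eq)
      (*-monoˡ-≤ P (*-cancelʳ-< P i q (subst (i * P <_) eq (≤-<-trans e (+-monoʳ-< t (d< i))))))

    -- One step down lowers the multiple of `P` by `P` and the delay by at most `P`, so the
    -- invariant survives.
    earliest-down : ∀ {i t} → Earliest (suc i) t → Earliest i t
    earliest-down {i} {t} e = +-cancelˡ-≤ P _ _ (≤-trans e (≤-trans (+-monoʳ-≤ t (d≤ i)) (≤-reflexive (swap t P (d i)))))
      where
      swap : ∀ t p d → t + (p + d) ≡ p + (t + d)
      swap = solve-∀

    earliest-switch : ∀ {c c′ t} → π G c t ≡ π G c′ t → Earliest (toℕ c) t → Earliest (toℕ c′) t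
    earliest-switch {c} {c′} {t} eq e with collide c c′ t eq
    ... | inj₁ refl             = e
    ... | inj₂ (inj₁ (up , P∣)) rewrite up = earliest-up P∣ e
    ... | inj₂ (inj₂ (down , _)) rewrite down = earliest-down {toℕ c′} e

    -- Every move takes one time step, so an arrival time bounds the number of moves. The invariant
    -- is carried through each change of carrier and is only relaxed as time passes.
    visited-earliest : ∀ cs c t → Earliest (toℕ c) t → ValidMoves G (π G c t) t cs → ∀ {s} → s ∈ visited G (π G c t) t cs →
      ∃ λ c′ → ∃ λ t′ → Earliest (toℕ c′) t′ × s ≡ π G c′ t′ × t′ ≤ t + length cs
    visited-earliest []        c t e v (here refl) = c , t , e , refl , m≤m+n t 0
    visited-earliest (c′ ∷ cs) c t e v (here refl) = c , t , e , refl , m≤m+n t _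
    visited-earliest (c′ ∷ cs) c t e (eq , v) (there s∈)
      with visited-earliest cs c′ (suc t) (m≤n⇒m≤1+n (earliest-switch {c} {c′} (sym eq) e)) v s∈
    ... | c″ , t″ , e″ , s≡ , t″≤ = c″ , t″ , e″ , s≡ , subst (t″ ≤_) (sym (+-suc t (length cs))) t″≤

-- The construction: sites, periods and routes.

module Construction (size : Parity → ℕ) (k : ℕ) (4≤k : 4 ≤ k) (k≤size : ∀ β → k ≤ size β) where

  -- One meeting site for each value of ⌊ j /2⌋ as the slot j runs from 0 to k.
  h : ℕ
  h = suc ⌊ k /2⌋

  instance
    size-nonZero : ∀ {β} → NonZero (size β)
    size-nonZero {β} = >-nonZero (≤-trans (s≤s z≤n) (≤-trans 4≤k (k≤size β)))

  data Site : Set where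
    area : (β : Parity) → Fin (size β) → Site
    meet : Fin h → Site

  n : ℕ
  n = size 0ℙ + (size 1ℙ + h)

  encode : Site → Fin n
  encode (area 0ℙ x) = x ↑ˡ (size 1ℙ + h)
  encode (area 1ℙ x) = size 0ℙ ↑ʳ (x ↑ˡ h)
  encode (meet m)    = size 0ℙ ↑ʳ (size 1ℙ ↑ʳ m)

  decode : Fin n → Site
  decode s with splitAt (size 0ℙ) s
  ... | inj₁ x = area 0ℙ x
  ... | inj₂ r with splitAt (size 1ℙ) r
  ... | inj₁ x = area 1ℙ x
  ... | inj₂ m = meet m

  decode-encode : ∀ z → decode (encode z) ≡ z
  decode-encode (area 0ℙ x) rewrite splitAt-↑ˡ (size 0ℙ) x (size 1ℙ + h) = refl
  decode-encode (area 1ℙ x) rewrite splitAt-↑ʳ (size 0ℙ) (size 1ℙ + h) (x ↑ˡ h) | splitAt-↑ˡ (size 1ℙ) x h = refl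
  decode-encode (meet m) rewrite splitAt-↑ʳ (size 0ℙ) (size 1ℙ + h) (size 1ℙ ↑ʳ m) | splitAt-↑ʳ (size 1ℙ) h m = refl

  encode-decode : ∀ s → encode (decode s) ≡ s
  encode-decode s with splitAt (size 0ℙ) s in eq
  ... | inj₁ x = splitAt⁻¹-↑ˡ eq
  ... | inj₂ r with splitAt (size 1ℙ) r in eq′
  ... | inj₁ x = trans (cong (size 0ℙ ↑ʳ_) (splitAt⁻¹-↑ˡ eq′)) (splitAt⁻¹-↑ʳ eq)
  ... | inj₂ m = trans (cong (size 0ℙ ↑ʳ_) (splitAt⁻¹-↑ʳ eq′)) (splitAt⁻¹-↑ʳ eq)

  encode-injective : ∀ {y z} → encode y ≡ encode z → y ≡ z
  encode-injective {y} {z} eq = trans (sym (decode-encode y)) (trans (cong decode eq) (decode-encode z))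

  -- This is U - 1; naming the predecessor keeps both half periods, `suc V` and `V`, free of
  -- subtraction.
  V : ℕ
  V = pred (size 0ℙ * size 1ℙ)

  4≤size : ∀ β → 4 ≤ size β
  4≤size β = ≤-trans 4≤k (k≤size β)

  suc-V : suc V ≡ size 0ℙ * size 1ℙ
  suc-V = suc-pred (size 0ℙ * size 1ℙ) {{m*n≢0 (size 0ℙ) (size 1ℙ)}}

  4k≤suc-V : 4 * k ≤ suc V
  4k≤suc-V = subst (4 * k ≤_) (sym suc-V) (*-mono-≤ (4≤size 0ℙ) (k≤size 1ℙ))

  15≤V : 15 ≤ V
  15≤V = s≤s⁻¹ (≤-trans (*-monoʳ-≤ 4 4≤k) 4k≤suc-V)

  halfPeriod : Parity → ℕ
  halfPeriod 0ℙ = suc V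
  halfPeriod 1ℙ = V

  15≤halfPeriod : ∀ β → 15 ≤ halfPeriod β
  15≤halfPeriod 0ℙ = m≤n⇒m≤1+n 15≤V
  15≤halfPeriod 1ℙ = 15≤V

  halfPeriod≤ : ∀ β → halfPeriod β ≤ size (β ⁻¹) * size β
  halfPeriod≤ 0ℙ = ≤-reflexive (trans suc-V (*-comm (size 0ℙ) (size 1ℙ)))
  halfPeriod≤ 1ℙ = ≤-trans (n≤1+n V) (≤-reflexive suc-V)

  periodOf : Parity → ℕ
  periodOf β = 2 * halfPeriod β

  period : ℕ → ℕ
  period c = periodOf (parity c)

  P : ℕ
  P = 2 * (suc V * V)

  period∣P : ∀ c → period c ∣ P
  period∣P c with parity c
  ... | 0ℙ = *-monoʳ-∣ {suc V} {suc V * V} 2 (m∣m*n V)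
  ... | 1ℙ = *-monoʳ-∣ {V} {suc V * V} 2 (n∣m*n (suc V))

  2∣period : ∀ c → 2 ∣ period c
  2∣period c = m∣m*n (halfPeriod (parity c))

  4<periodOf : ∀ β → 4 < periodOf β
  4<periodOf β = ≤-trans (m≤m+n 5 25) (*-monoʳ-≤ 2 (15≤halfPeriod β))

  periodOf>0 : ∀ β → 0 < periodOf β
  periodOf>0 β = ≤-<-trans z≤n (4<periodOf β)

  periodOf-nonZero : ∀ β → NonZero (periodOf β)
  periodOf-nonZero β = >-nonZero (periodOf>0 β)

  -- Carriers j − 1 and j meet at times congruent to − delay j modulo P.
  delay : ℕ → ℕ
  delay j = 3 * suc j

  -- The factor 3 is odd, so delays alternate in parity; a factor 1 would also do this, but would
  -- put the two slots of a carrier at adjacent times.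
  parity-delay : ∀ j → parity (delay j) ≡ parity (suc j)
  parity-delay j = *-homo-* 3 (suc j)

  phase : Parity → ℕ → ℕ
  phase β t = _%_ t (periodOf β) {{periodOf-nonZero β}}

  coordinate : (β e : Parity) → ℕ → ℕ
  coordinate β 0ℙ s = s
  coordinate β 1ℙ s = s / size β

  -- Areas alternate with time; the even-time coordinate runs fast and the odd-time one slowly,
  -- so that consecutive coordinates spell out s in base size β, and no directed edge repeats.
  base : Parity → ℕ → ℕ
  base β t = coordinate β (parity t) ⌊ phase β t /2⌋

  -- Carriers of equal parity have the same `base` at every time; the rotation by `c` separates
  -- them, as carrier numbers stay below the area size.
  regular : ℕ → ℕ → Site
  regular c t = area (parity t ℙ.+ parity c) ((base (parity c) t + c) mod size (parity t ℙ.+ parity c))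

  meeting : ℕ → Site
  meeting j = meet (⌊ j /2⌋ mod h)

  -- A carrier visits its meeting sites once in each of its own periods; neighbours are in their
  -- common slot together only when both periods divide, which happens once modulo `P`.
  site : ℕ → ℕ → Site
  site c t with period c ∣? t + delay c | period c ∣? t + delay (suc c)
  ... | yes _ | _     = meeting c
  ... | no _  | yes _ = meeting (suc c)
  ... | no _  | no _  = regular c t

  position : ℕ → ℕ → Site
  position c t = site c (phase (parity c) t)

  -- Keeps the reason for a position instead of its computation. The reason depends only on the time
  -- modulo the period, so later arguments can use absolute times.
  data At (c t : ℕ) : Site → Set where
    slot : ∀ j → j ≡ c ⊎ j ≡ suc c → period c ∣ t + delay j → At c t (meeting j)
    off  : ¬ (period c ∣ t + delay c) → ¬ (period c ∣ t + delay (suc c)) → At c t (regular c t)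

  at-site : ∀ c t → At c t (site c t)
  at-site c t with period c ∣? t + delay c | period c ∣? t + delay (suc c)
  ... | yes p∣ | _      = slot c (inj₁ refl) p∣
  ... | no _   | yes p∣ = slot (suc c) (inj₂ refl) p∣
  ... | no p∤  | no p∤′ = off p∤ p∤′

  parity-phase : ∀ c t → parity (phase (parity c) t) ≡ parity t
  parity-phase c t = sym (begin
    parity t                                        ≡⟨ cong parity (m≡m%n+[m/n]*n t (period c)) ⟩
    parity (phase (parity c) t + t / period c * period c)    ≡⟨ +-homo-+ (phase (parity c) t) (t / period c * period c) ⟩
    parity (phase (parity c) t) ℙ.+ parity (t / period c * period c)
      ≡⟨ cong (parity (phase (parity c) t) ℙ.+_) (2∣⇒parity≡0 (∣n⇒∣m*n (t / period c) (2∣period c))) ⟩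
    parity (phase (parity c) t) ℙ.+ 0ℙ                       ≡⟨ ℙ.+-identityʳ _ ⟩
    parity (phase (parity c) t)                              ∎)
    where
    open ≡-Reasoning
    instance _ = periodOf-nonZero (parity c)

  regular-phase : ∀ c t → regular c (phase (parity c) t) ≡ regular c t
  regular-phase c t rewrite parity-phase c t | m%n%n≡m%n t (period c) {{periodOf-nonZero (parity c)}} = refl

  at-phase : ∀ {c t z} → At c (phase (parity c) t) z → At c t z
  at-phase {c} {t} (slot j j∈ p∣) = slot j j∈ (∣-%+⇒∣-+ (period c) {{periodOf-nonZero (parity c)}} t (delay j) p∣)
  at-phase {c} {t} (off p∤ p∤′) = subst (At c t) (sym (regular-phase c t))
    (off (p∤ ∘ ∣-+⇒∣-%+ (period c) {{periodOf-nonZero (parity c)}} t _) (p∤′ ∘ ∣-+⇒∣-%+ (period c) {{periodOf-nonZero (parity c)}} t _))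

  at : ∀ c t → At c t (position c t)
  at c t = at-phase (at-site c (phase (parity c) t))

  G : PV n k
  G = record
    { period   = period ∘ toℕ
    ; period>0 = periodOf>0 ∘ parity ∘ toℕ
    ; route    = λ c r → encode (site (toℕ c) (toℕ r))
    }

  π-position : ∀ c t → π G c t ≡ encode (position (toℕ c) t)
  π-position c t = cong (λ r → encode (site (toℕ c) r)) (toℕ-fromℕ< (m%n<n t (period (toℕ c)) {{periodOf-nonZero (parity (toℕ c))}}))

  π⇒position : ∀ {c c′ t t′} → π G c t ≡ π G c′ t′ → position (toℕ c) t ≡ position (toℕ c′) t′
  π⇒position {c} {c′} {t} {t′} eq = encode-injective (trans (sym (π-position c t)) (trans eq (π-position c′ t′)))

  -- Which carriers can share a site, and when.

  area-parity : ∀ {β β′ x y} → area β x ≡ area β′ y → β ≡ β′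
  area-parity refl = refl

  area-coordinate : ∀ {β β′} x y → area β (x mod size β) ≡ area β′ (y mod size β′) → x % size β ≡ y % size β′
  area-coordinate {β} {β′} x y eq = trans (sym (toℕ-fromℕ< (m%n<n x (size β)))) (trans (index eq) (toℕ-fromℕ< (m%n<n y (size β′))))
    where
    index : ∀ {β β′ x y} → area β x ≡ area β′ y → toℕ x ≡ toℕ y
    index refl = refl

  half<h : ∀ {j} → j ≤ k → ⌊ j /2⌋ < h
  half<h j≤k = s≤s (⌊n/2⌋-mono j≤k)

  meeting-half : ∀ {i j} → i ≤ k → j ≤ k → meeting i ≡ meeting j → ⌊ i /2⌋ ≡ ⌊ j /2⌋
  meeting-half {i} {j} i≤k j≤k eq = %-<-injective (half<h i≤k) (half<h j≤k)
    (trans (sym (toℕ-fromℕ< (m%n<n ⌊ i /2⌋ h))) (trans (index eq) (toℕ-fromℕ< (m%n<n ⌊ j /2⌋ h))))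
    where
    index : ∀ {x y} → meet x ≡ meet y → toℕ x ≡ toℕ y
    index refl = refl

  slot≤k : ∀ {c j} → j ≡ c ⊎ j ≡ suc c → c < k → j ≤ k
  slot≤k (inj₁ refl) c<k = <⇒≤ c<k
  slot≤k (inj₂ refl) c<k = c<k

  slot-parity : ∀ c t j → period c ∣ t + delay j → parity t ≡ parity (suc j)
  slot-parity c t j p∣ = trans (2∣+⇒parity≡ t (∣-trans (2∣period c) p∣)) (parity-delay j)

  parity-suc-injective : ∀ i j → parity (suc i) ≡ parity (suc j) → parity i ≡ parity j
  parity-suc-injective i j eq = ⁻¹-injective (trans (sym (parity-suc i)) (trans eq (parity-suc j)))

  -- Slots that share a meeting site are used at times of opposite parity.
  slots-agree : ∀ {c c′ t t′} i j → i ≤ k → j ≤ k → parity t ≡ parity t′ →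
    period c ∣ t + delay i → period c′ ∣ t′ + delay j → meeting i ≡ meeting j → i ≡ j
  slots-agree {c} {c′} {t} {t′} i j i≤k j≤k t≡t′ p∣ p′∣ eq = parity-half-injective i j
    (parity-suc-injective i j (trans (sym (slot-parity c t i p∣)) (trans t≡t′ (slot-parity c′ t′ j p′∣))))
    (meeting-half i≤k j≤k eq)

  own-slots-agree : ∀ {c i j} → i ≡ c ⊎ i ≡ suc c → j ≡ c ⊎ j ≡ suc c → parity (suc i) ≡ parity (suc j) → i ≡ j
  own-slots-agree (inj₁ refl) (inj₁ refl) _ = refl
  own-slots-agree (inj₂ refl) (inj₂ refl) _ = refl
  own-slots-agree {c} (inj₁ refl) (inj₂ refl) eq = contradiction (trans (sym eq) (parity-suc c)) (p≢p⁻¹ (parity c))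
  own-slots-agree {c} (inj₂ refl) (inj₁ refl) eq = contradiction (trans eq (parity-suc c)) (p≢p⁻¹ (parity c))

  Collision : ℕ → ℕ → ℕ → Set
  Collision t c c′ = c ≡ c′ ⊎ (c′ ≡ suc c × P ∣ t + delay c′) ⊎ (c ≡ suc c′ × P ∣ t + delay c)

  P∣consecutive : ∀ c {x} → period c ∣ x → period (suc c) ∣ x → P ∣ x
  P∣consecutive c {x} ∣x ∣x′ = go (parity c) ∣x (subst (λ β → periodOf β ∣ x) (parity-suc c) ∣x′)
    where
    go : ∀ β → periodOf β ∣ x → periodOf (β ⁻¹) ∣ x → P ∣ x
    go 0ℙ e o = consecutive-∣ V e o
    go 1ℙ o e = consecutive-∣ V e o

  -- Two slots at one site at the same time are the same slot, which belongs only to two neighbours.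
  -- Two ordinary positions agree only in one area, hence for carriers of equal parity, and then the
  -- rotations must agree. A meeting site is never an ordinary one.
  collision : ∀ {c c′ t y z} → c < k → c′ < k → At c t y → At c′ t z → y ≡ z → Collision t c c′
  collision {c} {c′} {t} c<k c′<k (slot i i∈ p∣) (slot j j∈ p′∣) eq
    with slots-agree {c} {c′} {t} {t} i j (slot≤k i∈ c<k) (slot≤k j∈ c′<k) refl p∣ p′∣ eq
  collision _ _ (slot i (inj₁ refl) p∣) (slot i (inj₁ refl) p′∣) eq | refl = inj₁ refl
  collision _ _ (slot i (inj₂ refl) p∣) (slot i (inj₂ refl) p′∣) eq | refl = inj₁ refl
  collision {c} _ _ (slot i (inj₂ refl) p∣) (slot i (inj₁ refl) p′∣) eq | refl = inj₂ (inj₁ (refl , P∣consecutive c p∣ p′∣))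
  collision {c} {c′} _ _ (slot i (inj₁ refl) p∣) (slot i (inj₂ refl) p′∣) eq | refl = inj₂ (inj₂ (refl , P∣consecutive c′ p′∣ p∣))
  collision {c} {c′} {t} c<k c′<k (off _ _) (off _ _) eq = inj₁ (%-<-injective (<-≤-trans c<k (k≤size β)) (<-≤-trans c′<k (k≤size β))
    (%-+-cancelˡ (base (parity c) t) (size β)
      (trans (area-coordinate (base (parity c) t + c) (base (parity c′) t + c′) eq)
             (cong (λ γ → (base γ t + c′) % size (parity t ℙ.+ γ)) (sym same)))))
    where
    β : Parity
    β = parity t ℙ.+ parity c
    same : parity c ≡ parity c′
    same = ℙ.+-cancelˡ-≡ (parity t) _ _ (area-parity eq)

  -- Simplicity of the routes.

  no-adjacent-slots : ∀ c t i j → i ≡ c ⊎ i ≡ suc c → j ≡ c ⊎ j ≡ suc c →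
    period c ∣ t + delay i → ¬ (period c ∣ suc t + delay j)
  no-adjacent-slots c t i j i∈ j∈ p∣ p∣′ = go i∈ j∈ p∣ p∣′
    where
    -- With delays 3 apart, slots at adjacent times would make the period divide 1, 2 or 4.
    small : ∀ e → suc e ≤ 4 → ¬ (period c ∣ suc e)
    small e e≤4 p∣e = contradiction (∣⇒≤ p∣e) (<⇒≱ (≤-<-trans e≤4 (4<periodOf (parity c))))
    delay-suc : ∀ t c → suc t + 3 * suc (suc c) ≡ t + 4 + 3 * suc c
    delay-suc = solve-∀
    delay-suc′ : ∀ t c → t + 3 * suc (suc c) ≡ suc t + 2 + 3 * suc c
    delay-suc′ = solve-∀
    go : i ≡ c ⊎ i ≡ suc c → j ≡ c ⊎ j ≡ suc c → period c ∣ t + delay i → ¬ (period c ∣ suc t + delay j)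
    go (inj₁ refl) (inj₁ refl) a b = small 0 (s≤s z≤n) (∣-difference t 1 (delay c) a (subst (λ x → period c ∣ x + delay c) (sym (+-comm t 1)) b))
    go (inj₂ refl) (inj₂ refl) a b = small 0 (s≤s z≤n) (∣-difference t 1 (delay i) a (subst (λ x → period c ∣ x + delay i) (sym (+-comm t 1)) b))
    go (inj₁ refl) (inj₂ refl) a b = small 3 ≤-refl (∣-difference t 4 (delay c) a (subst (period c ∣_) (delay-suc t c) b))
    go (inj₂ refl) (inj₁ refl) a b = small 1 (s≤s (s≤s z≤n)) (∣-difference (suc t) 2 (delay c) b (subst (period c ∣_) (delay-suc′ t c) a))

  position-moves : ∀ {c t y z} → At c t y → At c (suc t) z → y ≢ z
  position-moves {c} {t} (slot i i∈ p∣) (slot j j∈ p∣′) eq = no-adjacent-slots c t i j i∈ j∈ p∣ p∣′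
  position-moves {c} {t} (off _ _) (off _ _) eq = p≢p⁻¹ (parity t)
    (trans (ℙ.+-cancelʳ-≡ (parity c) _ _ (area-parity eq)) (parity-suc t))

  -- A half period is at most the product of the two sizes, so the slow coordinate stays below the
  -- size of the other area and reduction there loses nothing.
  slow-injective : ∀ β {s s′} → s < halfPeriod β → s′ < halfPeriod β →
    (s / size β) % size (β ⁻¹) ≡ (s′ / size β) % size (β ⁻¹) → s / size β ≡ s′ / size β
  slow-injective β s< s′< = %-<-injective (slow< s<) (slow< s′<)
    where
    slow< : ∀ {s} → s < halfPeriod β → s / size β < size (β ⁻¹)
    slow< s< = m<n*o⇒m/o<n (<-≤-trans s< (halfPeriod≤ β))

  next : Parity → ℕ → ℕ
  next β i = ⌊ phase β (suc i) /2⌋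

  next-cases : ∀ β i → parity i ≡ 1ℙ → i < periodOf β →
    next β i ≡ suc ⌊ i /2⌋ ⊎ (next β i ≡ 0 × suc ⌊ i /2⌋ ≡ halfPeriod β)
  next-cases β i odd i<p with m≤n⇒m<n∨m≡n i<p
  ... | inj₁ si<p = inj₁ (trans (cong ⌊_/2⌋ (m<n⇒m%n≡m {{periodOf-nonZero β}} si<p)) (half-suc-odd i odd))
  ... | inj₂ si≡p = inj₂
    ( cong ⌊_/2⌋ (trans (cong (phase β) si≡p) (n%n≡0 (periodOf β) {{periodOf-nonZero β}}))
    , trans (sym (half-suc-odd i odd)) (trans (cong ⌊_/2⌋ si≡p) (half-2* (halfPeriod β))))

  -- The closing edge of a period starts in the last block of the slow coordinate; the only other edge
  -- of that block towards fast coordinate 0 would start at the end of the block, which is not earlier.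
  wrap-injective : ∀ β {s s′} → suc s ≡ halfPeriod β → s′ < halfPeriod β →
    s / size β ≡ s′ / size β → suc s′ % size β ≡ 0 → s ≡ s′
  wrap-injective β {s} {s′} last s′< q≡ r≡0 = ≤-antisym s≤s′ (s≤s⁻¹ (subst (s′ <_) (sym last) s′<))
    where
    open ≤-Reasoning
    s≤s′ : s ≤ s′
    s≤s′ = begin
      s                                      ≡⟨ m≡m%n+[m/n]*n s (size β) ⟩
      s % size β + s / size β * size β       ≤⟨ +-monoˡ-≤ _ (∸-monoˡ-≤ 1 (m%n<n s (size β))) ⟩
      size β ∸ 1 + s / size β * size β       ≡⟨ cong₂ (λ r q → r + q * size β) (sym (%-pred-≡0 {s′} r≡0)) q≡ ⟩
      s′ % size β + s′ / size β * size β     ≡⟨ m≡m%n+[m/n]*n s′ (size β) ⟨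
      s′                                     ∎

  -- Such an edge shows the quotient of s and the remainder of its successor. Away from the end of
  -- the period these determine s; `wrap-injective` compares the closing edge with the others.
  odd-edge-injective : ∀ β {i j} → parity i ≡ 1ℙ → parity j ≡ 1ℙ → i < periodOf β → j < periodOf β →
    ⌊ i /2⌋ / size β ≡ ⌊ j /2⌋ / size β → next β i % size β ≡ next β j % size β → ⌊ i /2⌋ ≡ ⌊ j /2⌋
  odd-edge-injective β {i} {j} oi oj i< j< q≡ r≡ with next-cases β i oi i< | next-cases β j oj j<
  ... | inj₁ ni | inj₁ nj = divMod-injective _ _ (size β)
    (%-+-cancelˡ 1 (size β) (trans (cong (_% size β) (sym ni)) (trans r≡ (cong (_% size β) nj)))) q≡
  ... | inj₂ (_ , li) | inj₂ (_ , lj) = suc-injective (trans li (sym lj))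
  ... | inj₂ (zi , li) | inj₁ nj = wrap-injective β li (half<⇒ j<) q≡
    (trans (cong (_% size β) (sym nj)) (trans (sym r≡) (trans (cong (_% size β) zi) (m*n%n≡0 0 (size β)))))
  ... | inj₁ ni | inj₂ (zj , lj) = sym (wrap-injective β lj (half<⇒ i<) (sym q≡)
    (trans (cong (_% size β) (sym ni)) (trans r≡ (trans (cong (_% size β) zj) (m*n%n≡0 0 (size β))))))

  regular-base : ∀ c i j → regular c i ≡ regular c j → parity i ≡ parity j →
    base (parity c) i % size (parity i ℙ.+ parity c) ≡ base (parity c) j % size (parity j ℙ.+ parity c)
  regular-base c i j eq same = trans
    (%-+-cancelʳ c (size (parity i ℙ.+ parity c))
      (trans (area-coordinate (base (parity c) i + c) (base (parity c) j + c) eq)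
             (cong (λ e → (base (parity c) j + c) % size (e ℙ.+ parity c)) (sym same))))
    (cong (λ e → base (parity c) j % size (e ℙ.+ parity c)) same)

  -- Let s be half the time. An edge from an even time shows both digits of s in base `size β`; an
  -- edge from an odd time shows the high digit of s and the low digit of the next s.
  base-edge-injective : ∀ β i j → parity i ≡ parity j → i < periodOf β → j < periodOf β →
    base β i % size (parity i ℙ.+ β) ≡ base β j % size (parity j ℙ.+ β) →
    base β (suc i) % size (parity (suc i) ℙ.+ β) ≡ base β (suc j) % size (parity (suc j) ℙ.+ β) → i ≡ j
  base-edge-injective β i j same i< j< eq eq′
    rewrite parity-suc i | parity-suc j | m<n⇒m%n≡m {{periodOf-nonZero β}} i< | m<n⇒m%n≡m {{periodOf-nonZero β}} j<
    with parity i in pi | parity j in pj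
  ... | 0ℙ | 0ℙ = parity-half-injective i j (trans pi (sym pj)) (divMod-injective _ _ (size β) eq
        (slow-injective β (half<⇒ i<) (half<⇒ j<)
          (trans (cong (λ s → s / size β % size (β ⁻¹)) (sym (next-even i pi i<)))
                 (trans eq′ (cong (λ s → s / size β % size (β ⁻¹)) (next-even j pj j<))))))
    where
    -- The period is even, so its last time is odd and no wrap follows an even time.
    next-even : ∀ i → parity i ≡ 0ℙ → i < periodOf β → next β i ≡ ⌊ i /2⌋
    next-even i even i< = trans (cong ⌊_/2⌋ (m<n⇒m%n≡m {{periodOf-nonZero β}} (≤∧≢⇒< i< si≢p))) (half-suc-even i even)
      where
      si≢p : suc i ≢ periodOf β
      si≢p si≡p with trans (sym (parity-2* (halfPeriod β))) (trans (cong parity (sym si≡p)) (trans (parity-suc i) (cong _⁻¹ even)))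
      ... | ()
  ... | 1ℙ | 1ℙ = parity-half-injective i j (trans pi (sym pj)) (odd-edge-injective β pi pj i< j<
        (slow-injective β (half<⇒ i<) (half<⇒ j<) eq) eq′)

  -- Slots are never adjacent, so every edge has an ordinary endpoint, and the area of that endpoint
  -- reveals the parity of the time.
  edge-parity : ∀ {c i j y y′ z z′} → At c i y → At c (suc i) y′ → At c j z → At c (suc j) z′ → y ≡ z → y′ ≡ z′ →
    parity i ≡ parity j
  edge-parity {c} (off _ _) _ (off _ _) _ eq _ = ℙ.+-cancelʳ-≡ (parity c) _ _ (area-parity eq)
  edge-parity {c} {i} {j} (slot _ _ _) (off _ _) (slot _ _ _) (off _ _) _ eq =
    parity-suc-injective i j (ℙ.+-cancelʳ-≡ (parity c) _ _ (area-parity eq))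
  edge-parity {c} {i} (slot u u∈ p∣) (slot v v∈ p∣′) _ _ _ _ = contradiction p∣′ (no-adjacent-slots c i u v u∈ v∈ p∣)
  edge-parity {c} {i} {j} _ _ (slot u u∈ p∣) (slot v v∈ p∣′) _ _ = contradiction p∣′ (no-adjacent-slots c j u v u∈ v∈ p∣)

  -- A slot at either end fixes the time modulo the period; an edge between ordinary sites is
  -- determined by its digits once the rotation is cancelled.
  edge-injective : ∀ {c i j y y′ z z′} → c < k → i < period c → j < period c →
    At c i y → At c (suc i) y′ → At c j z → At c (suc j) z′ → parity i ≡ parity j → y ≡ z → y′ ≡ z′ → i ≡ j
  edge-injective {c} {i} {j} c<k i< j< (slot u u∈ p∣) _ (slot v v∈ p∣′) _ same eq _
    with slots-agree {c} {c} {i} {j} u v (slot≤k u∈ c<k) (slot≤k v∈ c<k) same p∣ p∣′ eq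
  ... | refl = ∣-shift-unique (delay u) p∣ p∣′ i< j<
  edge-injective {c} {i} {j} c<k i< j< _ (slot u u∈ p∣) _ (slot v v∈ p∣′) same _ eq
    with slots-agree {c} {c} {suc i} {suc j} u v (slot≤k u∈ c<k) (slot≤k v∈ c<k)
           (trans (parity-suc i) (trans (cong _⁻¹ same) (sym (parity-suc j)))) p∣ p∣′ eq
  ... | refl = ∣-shift-unique (suc (delay u)) (subst (period c ∣_) (sym (+-suc i (delay u))) p∣) (subst (period c ∣_) (sym (+-suc j (delay u))) p∣′) i< j<
  edge-injective {c} {i} {j} c<k i< j< (off _ _) (off _ _) (off _ _) (off _ _) same eq eq′ =
    base-edge-injective (parity c) i j same i< j< (regular-base c i j eq same)
      (regular-base c (suc i) (suc j) eq′ (trans (parity-suc i) (trans (cong _⁻¹ same) (sym (parity-suc j)))))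

  simple : Simple G
  simple c = (λ i eq → position-moves (at c′ i) (at c′ (suc i)) (π⇒position {c} {c} eq))
           , λ i j i< j< eq eq′ →
               let y≡z = π⇒position {c} {c} eq
                   y′≡z′ = π⇒position {c} {c} eq′
               in edge-injective (toℕ<n c) i< j< (at c′ i) (at c′ (suc i)) (at c′ j) (at c′ (suc j))
                    (edge-parity (at c′ i) (at c′ (suc i)) (at c′ j) (at c′ (suc j)) y≡z y′≡z′) y≡z y′≡z′
    where
    c′ : ℕ
    c′ = toℕ c

  -- Feasibility and heterogeneity.

  open Exploration G

  P-nonZero : NonZero P
  P-nonZero = >-nonZero (<-≤-trans (periodOf>0 1ℙ) (*-monoʳ-≤ 2 (m≤m+n V (V * V))))

  -- As P ≥ 1, `P * (t + D)` is at least `t + D`, so subtracting `D` is exact and leaves at least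
  -- `t`.
  late-multiple : ∀ D → Infinitely (λ t → P ∣ t + D)
  late-multiple D t = P * (t + D) ∸ D , m+n≤o⇒m≤o∸n t t+D≤
    , subst (P ∣_) (sym (m∸n+n≡m (≤-trans (m≤n+m D t) t+D≤))) (m∣m*n (t + D))
    where
    t+D≤ : t + D ≤ P * (t + D)
    t+D≤ = m≤n*m (t + D) P {{P-nonZero}}

  -- `site` tests the lower slot first; this never hides the upper one, since the two occur at times
  -- of opposite parity.
  at-slot : ∀ {c t z} j → j ≡ c ⊎ j ≡ suc c → period c ∣ t + delay j → At c t z → z ≡ meeting j
  at-slot {c} {t} j j∈ p∣ (slot i i∈ p∣′) = cong meeting
    (own-slots-agree i∈ j∈ (trans (sym (slot-parity c t i p∣′)) (slot-parity c t j p∣)))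
  at-slot j (inj₁ refl) p∣ (off p∤ _) = contradiction p∣ p∤
  at-slot j (inj₂ refl) p∣ (off _ p∤) = contradiction p∣ p∤

  π-slot : ∀ c {t} j → j ≡ toℕ c ⊎ j ≡ suc (toℕ c) → P ∣ t + delay j → π G c t ≡ encode (meeting j)
  π-slot c {t} j j∈ P∣ = trans (π-position c t)
    (cong encode (at-slot j j∈ (∣-trans (period∣P (toℕ c)) P∣) (at (toℕ c) t)))

  meet-next : ∀ c c′ → toℕ c′ ≡ suc (toℕ c) → Infinitely (λ t → π G c t ≡ π G c′ t)
  meet-next c c′ eq t with late-multiple (delay (toℕ c′)) t
  ... | t′ , t≤t′ , P∣ = t′ , t≤t′ , trans (π-slot c (toℕ c′) (inj₂ eq) P∣) (sym (π-slot c′ (toℕ c′) (inj₁ refl) P∣))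

  0<k : 0 < k
  0<k = ≤-trans (s≤s z≤n) 4≤k

  c₀ : Fin k
  c₀ = fromℕ< 0<k

  c₀≡0 : toℕ c₀ ≡ 0
  c₀≡0 = toℕ-fromℕ< 0<k

  -- Carrier 0 has delays 3 and 6, so both its slots lie in the last six times of its period.
  site-off : ∀ r → r + 6 < periodOf 0ℙ → site 0 r ≡ regular 0 r
  site-off r r+6<p = go (at-site 0 r)
    where
    small : ∀ e → r + suc e < periodOf 0ℙ → ¬ (periodOf 0ℙ ∣ r + suc e)
    small e r+e<p p∣ = contradiction (∣⇒≤ {{>-nonZero (m≤n⇒m≤o+n r (s≤s z≤n))}} p∣) (<⇒≱ r+e<p)
    go : ∀ {z} → At 0 r z → z ≡ regular 0 r
    go (slot _ (inj₁ refl) p∣) = contradiction p∣ (small 2 (≤-<-trans (+-monoʳ-≤ r (m≤m+n 3 3)) r+6<p))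
    go (slot _ (inj₂ refl) p∣) = contradiction p∣ (small 5 r+6<p)
    go (off _ _) = refl

  regular-0 : ∀ e r (x : Fin (size e)) → parity r ≡ e → base 0ℙ r ≡ toℕ x → regular 0 r ≡ area e x
  regular-0 e r x even eq = trans (cong₂ area′ even (trans (+-identityʳ _) eq)) (go e x)
    where
    area′ : Parity → ℕ → Site
    area′ e v = area (e ℙ.+ 0ℙ) (v mod size (e ℙ.+ 0ℙ))
    toℕ-mod : ∀ {m} .{{_ : NonZero m}} (x : Fin m) → toℕ x mod m ≡ x
    toℕ-mod {m} x = toℕ-injective (trans (toℕ-fromℕ< (m%n<n (toℕ x) m)) (m<n⇒m%n≡m (toℕ<n x)))
    go : ∀ e (x : Fin (size e)) → area′ e (toℕ x) ≡ area e x
    go 0ℙ x = cong (area 0ℙ) (toℕ-mod x)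
    go 1ℙ x = cong (area 1ℙ) (toℕ-mod x)

  visits-regular : ∀ e r (x : Fin (size e)) → r + 6 < periodOf 0ℙ → parity r ≡ e → coordinate 0ℙ e ⌊ r /2⌋ ≡ toℕ x →
    Infinitely (λ t → π G c₀ t ≡ encode (area e x))
  visits-regular e r x r+6<p even eq t = r + t * p , ≤-trans (m≤m*n t p) (m≤n+m (t * p) r) , (begin
    π G c₀ (r + t * p)                            ≡⟨ π-position c₀ (r + t * p) ⟩
    encode (position (toℕ c₀) (r + t * p))        ≡⟨ cong (λ c → encode (position c (r + t * p))) c₀≡0 ⟩
    encode (site 0 ((r + t * p) % p))             ≡⟨ cong (λ u → encode (site 0 u)) (trans ([m+kn]%n≡m%n r t p) r%p≡r) ⟩
    encode (site 0 r)                             ≡⟨ cong encode (site-off r r+6<p) ⟩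
    encode (regular 0 r)                          ≡⟨ cong encode (regular-0 e r x even
                                                       (trans (cong₂ (λ e u → coordinate 0ℙ e ⌊ u /2⌋) even r%p≡r) eq)) ⟩
    encode (area e x)                             ∎)
    where
    open ≡-Reasoning
    p : ℕ
    p = periodOf 0ℙ
    instance
      p-nonZero : NonZero p
      p-nonZero = periodOf-nonZero 0ℙ
    r%p≡r : r % p ≡ r
    r%p≡r = m<n⇒m%n≡m (≤-<-trans (m≤m+n r 6) r+6<p)

  -- Carrier 0 covers both areas: the fast coordinate is x at time 2x, and the slow one is x at time
  -- 2s + 1 with s = x · `size 0ℙ`. Sizes of at least 4 keep these times clear of the slots.
  visits-area : ∀ e (x : Fin (size e)) → Infinitely (λ t → π G c₀ t ≡ encode (area e x))
  visits-area 0ℙ x = visits-regular 0ℙ (2 * toℕ x) x bound (parity-2* (toℕ x)) (half-2* (toℕ x))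
    where
    open ≤-Reasoning
    bound : 2 * toℕ x + 6 < periodOf 0ℙ
    bound = begin-strict
      2 * toℕ x + 6            ≡⟨ *-distribˡ-+ 2 (toℕ x) 3 ⟨
      2 * (toℕ x + 3)          <⟨ *-monoʳ-< 2 (+-mono-<-≤ (toℕ<n x) (≤-trans (n≤1+n 3) (4≤size 0ℙ))) ⟩
      2 * (size 0ℙ + size 0ℙ)  ≡⟨ cong (λ a → 2 * (size 0ℙ + a)) (sym (+-identityʳ (size 0ℙ))) ⟩
      2 * (2 * size 0ℙ)        ≡⟨ cong (2 *_) (*-comm 2 (size 0ℙ)) ⟩
      2 * (size 0ℙ * 2)        ≤⟨ *-monoʳ-≤ 2 (*-monoʳ-≤ (size 0ℙ) (≤-trans (m≤m+n 2 2) (4≤size 1ℙ))) ⟩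
      2 * (size 0ℙ * size 1ℙ)  ≡⟨ cong (2 *_) suc-V ⟨
      periodOf 0ℙ              ∎
  visits-area 1ℙ x = visits-regular 1ℙ (suc (2 * s)) x bound (trans (parity-suc (2 * s)) (cong _⁻¹ (parity-2* s)))
      (trans (cong (_/ size 0ℙ) (trans (half-suc-even (2 * s) (parity-2* s)) (half-2* s))) (m*n/n≡m (toℕ x) (size 0ℙ)))
    where
    open ≤-Reasoning
    s : ℕ
    s = toℕ x * size 0ℙ
    regroup : ∀ s → suc (suc (2 * s) + 6) ≡ 2 * (4 + s)
    regroup = solve-∀
    bound : suc (2 * s) + 6 < periodOf 0ℙ
    bound = begin
      suc (suc (2 * s) + 6)              ≡⟨ regroup s ⟩
      2 * (4 + s)                        ≤⟨ *-monoʳ-≤ 2 (+-monoˡ-≤ s (4≤size 0ℙ)) ⟩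
      2 * (suc (toℕ x) * size 0ℙ)        ≤⟨ *-monoʳ-≤ 2 (*-monoˡ-≤ (size 0ℙ) (toℕ<n x)) ⟩
      2 * (size 1ℙ * size 0ℙ)            ≡⟨ cong (2 *_) (trans (*-comm (size 1ℙ) (size 0ℙ)) (sym suc-V)) ⟩
      periodOf 0ℙ                        ∎

  -- Meeting site m serves slots 2m and 2m + 1; carrier 2m ∸ 1 uses one of them as its upper slot.
  visits-meet : ∀ (m : Fin h) → ∃ λ c → Infinitely (λ t → π G c t ≡ encode (meet m))
  visits-meet m = c , λ t → let (t′ , t≤t′ , P∣) = late-multiple (delay (suc (toℕ c))) t in
    t′ , t≤t′ , trans (π-slot c (suc (toℕ c)) (inj₂ refl) P∣) (cong (encode ∘ meet) (toℕ-injective (begin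
      toℕ (⌊ suc (toℕ c) /2⌋ mod h)  ≡⟨ toℕ-fromℕ< (m%n<n ⌊ suc (toℕ c) /2⌋ h) ⟩
      ⌊ suc (toℕ c) /2⌋ % h          ≡⟨ cong (λ i → ⌊ suc i /2⌋ % h) (toℕ-fromℕ< (index<k (toℕ m) (toℕ<n m))) ⟩
      ⌊ suc (2 * toℕ m ∸ 1) /2⌋ % h  ≡⟨ cong (_% h) (half-index (toℕ m)) ⟩
      toℕ m % h                      ≡⟨ m<n⇒m%n≡m (toℕ<n m) ⟩
      toℕ m                          ∎)))
    where
    open ≡-Reasoning
    half-index : ∀ m → ⌊ suc (2 * m ∸ 1) /2⌋ ≡ m
    half-index zero    = refl
    half-index (suc m) = half-2* (suc m)
    index<k : ∀ m → m < h → 2 * m ∸ 1 < k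
    index<k zero    _   = 0<k
    index<k (suc m) m<h = ≤-trans (*-monoʳ-≤ 2 (s≤s⁻¹ m<h)) (2*half≤ k)
    c : Fin k
    c = fromℕ< (index<k (toℕ m) (toℕ<n m))

  visits-site : ∀ z → ∃ λ c → Infinitely (λ t → π G c t ≡ encode z)
  visits-site (area e x) = c₀ , visits-area e x
  visits-site (meet m)   = visits-meet m

  G-feasible : Feasible G
  G-feasible = feasible meet-next λ s →
    let (c , late) = visits-site (decode s) in
    c , λ t → let (t′ , t≤t′ , eq) = late t in t′ , t≤t′ , trans eq (encode-decode s)

  heterogeneous : Heterogeneous G
  heterogeneous = c₀ , fromℕ< 1<k , λ eq → 1+n≢n (*-cancelˡ-≡ (suc V) V 2
    (trans (cong period (sym c₀≡0)) (trans eq (cong period (toℕ-fromℕ< 1<k)))))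
    where
    1<k : 1 < k
    1<k = ≤-trans (m≤m+n 2 2) 4≤k

  -- The lower bound for the constructed graph.

  delay<delay-suc : ∀ i → delay i < delay (suc i)
  delay<delay-suc i = *-monoʳ-< 3 (n<1+n (suc i))

  delay≤P : delay k ≤ P
  delay≤P = begin
    3 * suc k      ≡⟨ *-suc 3 k ⟩
    3 + 3 * k      ≤⟨ +-monoˡ-≤ (3 * k) (≤-trans (n≤1+n 3) 4≤k) ⟩
    4 * k          ≤⟨ 4k≤suc-V ⟩
    suc V          ≤⟨ m≤m*n (suc V) V {{>-nonZero (≤-trans (s≤s z≤n) 15≤V)}} ⟩
    suc V * V      ≤⟨ m≤n*m (suc V * V) 2 ⟩
    P              ∎
    where open ≤-Reasoning

  delay-suc≤ : ∀ i → delay (suc i) ≤ P + delay i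
  delay-suc≤ i = ≤-trans (≤-reflexive (*-suc 3 (suc i))) (+-monoˡ-≤ (delay i) (≤-trans (*-monoʳ-≤ 3 (s≤s z≤n)) delay≤P))

  collide : ∀ c c′ t → π G c t ≡ π G c′ t →
    c ≡ c′ ⊎ (toℕ c′ ≡ suc (toℕ c) × P ∣ t + delay (toℕ c′)) ⊎ (toℕ c ≡ suc (toℕ c′) × P ∣ t + delay (toℕ c))
  collide c c′ t eq with collision (toℕ<n c) (toℕ<n c′) (at (toℕ c) t) (at (toℕ c′) t) (π⇒position {c} {c′} eq)
  ... | inj₁ c≡c′ = inj₁ (toℕ-injective c≡c′)
  ... | inj₂ rest = inj₂ rest

  -- A slot at this site has half ⌊ k /2⌋, hence number at least k - 1, and slot j is used only by
  -- carriers j - 1 and j.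
  last-meeting : ∀ {c t z} → c < k → At c t z → z ≡ meeting k → k ∸ 2 ≤ c
  last-meeting {c} c<k (slot j j∈ _) eq = ∸-monoˡ-≤ 2 (begin
    k                        ≤⟨ ≤suc-2*half k ⟩
    suc (2 * ⌊ k /2⌋)        ≡⟨ cong (λ i → suc (2 * i)) (meeting-half (slot≤k j∈ c<k) ≤-refl eq) ⟨
    suc (2 * ⌊ j /2⌋)        ≤⟨ s≤s (2*half≤ j) ⟩
    suc j                    ≤⟨ s≤s (j≤ j∈) ⟩
    suc (suc c)              ∎)
    where
    open ≤-Reasoning
    j≤ : j ≡ c ⊎ j ≡ suc c → j ≤ suc c
    j≤ (inj₁ refl) = n≤1+n c
    j≤ (inj₂ refl) = ≤-refl
    ≤suc-2*half : ∀ n → n ≤ suc (2 * ⌊ n /2⌋)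
    ≤suc-2*half 0 = z≤n
    ≤suc-2*half 1 = s≤s z≤n
    ≤suc-2*half (suc (suc n)) = subst (suc (suc n) ≤_) (cong suc (sym (*-suc 2 ⌊ n /2⌋))) (s≤s (s≤s (≤suc-2*half n)))

  -- The invariant is trivial for carrier 0 at time 0, and the last meeting site forces a carrier
  -- numbered at least k - 2. Its delay costs at most one `P`, which turns k - 2 into k - 3.
  exploration-length : ∀ cs → Explores G (π G c₀ 0) cs → (k ∸ 3) * P ≤ length cs
  exploration-length cs (valid , all)
    with visited-earliest P delay delay<delay-suc delay-suc≤ collide cs c₀ 0 (subst (λ i → i * P ≤ delay i) (sym c₀≡0) z≤n) valid (all (encode (meeting k)))
  ... | c , t , e , s≡ , t≤ = ≤-trans (+-cancelʳ-≤ P _ _ (begin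
    (k ∸ 3) * P + P          ≡⟨ +-comm _ P ⟩
    suc (k ∸ 3) * P          ≡⟨ cong (_* P) (sym (+-∸-assoc 1 (≤-trans (n≤1+n 3) 4≤k))) ⟩
    (k ∸ 2) * P              ≤⟨ *-monoˡ-≤ P (last-meeting (toℕ<n c) (at (toℕ c) t) (encode-injective (trans (sym (π-position c t)) (sym s≡)))) ⟩
    toℕ c * P                ≤⟨ e ⟩
    t + delay (toℕ c)        ≤⟨ +-monoʳ-≤ t (≤-trans (*-monoʳ-≤ 3 (s≤s (<⇒≤ (toℕ<n c)))) delay≤P) ⟩
    t + P                    ∎)) t≤
    where open ≤-Reasoning

  M≥-multiple : ∀ X d → X ≤ d * P → M≥ G ((k ∸ 3) * X) d
  M≥-multiple X d X≤ σ explores = π G c₀ 0 , (c₀ , refl) , (begin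
    (k ∸ 3) * X              ≤⟨ *-monoʳ-≤ (k ∸ 3) X≤ ⟩
    (k ∸ 3) * (d * P)        ≡⟨ swap (k ∸ 3) d P ⟩
    d * ((k ∸ 3) * P)        ≤⟨ *-monoʳ-≤ d (exploration-length _ (explores (π G c₀ 0) (c₀ , refl))) ⟩
    d * length (σ (π G c₀ 0) (c₀ , refl)) ∎)
    where
    open ≤-Reasoning
    swap : ∀ x y z → x * (y * z) ≡ y * (x * z)
    swap = solve-∀

-- Numerical estimates and choice of the area sizes.

square-≤-product : ∀ N V → 9 ≤ V → 16 * N ≤ 81 * suc V → N * N ≤ 16 * (2 * (suc V * V))
square-≤-product N V 9≤V 16N≤ = *-cancelˡ-≤ 64 (begin
  64 * (N * N)                        ≡⟨ regroup N ⟩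
  (8 * N) * (8 * N)                   ≤⟨ *-mono-≤ (≤-trans 8N≤45V (*-monoʳ-≤ 45 (n≤1+n V))) 8N≤45V ⟩
  (45 * suc V) * (45 * V)             ≡⟨ regroup′ (suc V) V ⟩
  -- 45² = 2025 fits just below 2048 = 64 · 32.
  2025 * (suc V * V)                  ≤⟨ *-monoˡ-≤ (suc V * V) (m≤m+n 2025 23) ⟩
  2048 * (suc V * V)                  ≡⟨ regroup″ (suc V * V) ⟩
  64 * (16 * (2 * (suc V * V)))       ∎)
  where
  open ≤-Reasoning
  regroup : ∀ N → 64 * (N * N) ≡ (8 * N) * (8 * N)
  regroup = solve-∀
  regroup′ : ∀ x y → (45 * x) * (45 * y) ≡ 2025 * (x * y)
  regroup′ = solve-∀
  regroup″ : ∀ x → 2048 * x ≡ 64 * (16 * (2 * x))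
  regroup″ = solve-∀
  -- Passing from `suc V` to `V` raises the constant from 81 to 90, which `9 ≤ V` allows.
  8N≤45V : 8 * N ≤ 45 * V
  8N≤45V = *-cancelˡ-≤ 2 (begin
    2 * (8 * N)       ≡⟨ *-assoc 2 8 N ⟨
    16 * N            ≤⟨ 16N≤ ⟩
    81 * suc V        ≡⟨ *-suc 81 V ⟩
    81 + 81 * V       ≤⟨ +-monoˡ-≤ (81 * V) (*-monoʳ-≤ 9 9≤V) ⟩
    9 * V + 81 * V    ≡⟨ *-distribʳ-+ V 9 81 ⟨
    90 * V            ≡⟨ *-assoc 2 45 V ⟩
    2 * (45 * V)      ∎)

-- Meeting sites take at most n/12 and rounding at most 1 ≤ n/36; the remaining 8n/9 leave 4n/9 for
-- the smaller area.
area-size-bound : ∀ n h → 36 ≤ n → 12 * h ≤ n → 4 * n ≤ 9 * ⌊ n ∸ h /2⌋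
area-size-bound n h 36≤n 12h≤n = *-cancelˡ-≤ 8 (+-cancelˡ-≤ (4 * n) _ _ (begin
  4 * n + 8 * (4 * n)              ≡⟨ regroup n ⟩
  36 * n                           ≤⟨ *-monoʳ-≤ 36 n≤ ⟩
  36 * (suc (a + a) + h)           ≡⟨ regroup′ a h ⟩
  36 + 3 * (12 * h) + 8 * (9 * a)  ≤⟨ +-monoˡ-≤ (8 * (9 * a)) (+-mono-≤ 36≤n (*-monoʳ-≤ 3 12h≤n)) ⟩
  4 * n + 8 * (9 * a)              ∎))
  where
  open ≤-Reasoning
  a : ℕ
  a = ⌊ n ∸ h /2⌋
  regroup : ∀ n → 4 * n + 8 * (4 * n) ≡ 36 * n
  regroup = solve-∀
  regroup′ : ∀ a h → 36 * (suc (a + a) + h) ≡ 36 + 3 * (12 * h) + 8 * (9 * a)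
  regroup′ = solve-∀
  n≤ : n ≤ suc (a + a) + h
  n≤ = begin
    n                            ≤⟨ m≤n+m∸n n h ⟩
    h + (n ∸ h)                  ≡⟨ +-comm h (n ∸ h) ⟩
    n ∸ h + h                    ≡⟨ cong (_+ h) (⌊n/2⌋+⌈n/2⌉≡n (n ∸ h)) ⟨
    a + ⌈ n ∸ h /2⌉ + h          ≤⟨ +-monoˡ-≤ h (+-monoʳ-≤ a (⌊n/2⌋-mono (n≤1+n (suc (n ∸ h))))) ⟩
    a + suc a + h                ≡⟨ cong (_+ h) (+-suc a a) ⟩
    suc (a + a) + h              ∎

-- The bound k ≤ n/6 - 2 is cleared of fractions, and both truncated subtractions are exact in this
-- range.
theorem6 : (n k : ℕ) → 36 ≤ n → 4 ≤ k → 6 * (k + 2) ≤ n →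
    Σ (PV n k) λ G → Feasible G × Simple G × Heterogeneous G ×
    M≥ G ((k ∸ 3) * (n * n ∸ 2 * n) ^ 2) 16
-- The construction has `a + (b + h)` sites, a number equal to `n` only up to a proof.
theorem6 n k 36≤n 4≤k 6[k+2]≤n = subst
  (λ m → Σ (PV m k) λ G → Feasible G × Simple G × Heterogeneous G × M≥ G ((k ∸ 3) * (n * n ∸ 2 * n) ^ 2) 16)
  n≡ (G , G-feasible , simple , heterogeneous , M≥-multiple _ 16 bound)
  where
  h a b : ℕ
  h = suc ⌊ k /2⌋
  a = ⌊ n ∸ h /2⌋
  b = ⌈ n ∸ h /2⌉

  12h≤n : 12 * h ≤ n
  12h≤n = begin
    12 * h                     ≡⟨ regroup ⌊ k /2⌋ ⟩
    6 * (2 * ⌊ k /2⌋ + 2)      ≤⟨ *-monoʳ-≤ 6 (+-monoˡ-≤ 2 (2*half≤ k)) ⟩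
    6 * (k + 2)                ≤⟨ 6[k+2]≤n ⟩
    n                          ∎
    where
    open ≤-Reasoning
    regroup : ∀ x → 12 * suc x ≡ 6 * (2 * x + 2)
    regroup = solve-∀

  4n≤9a : 4 * n ≤ 9 * a
  4n≤9a = area-size-bound n h 36≤n 12h≤n

  k≤a : k ≤ a
  k≤a = *-cancelˡ-≤ 9 (begin
    9 * k              ≤⟨ *-monoˡ-≤ k (m≤m+n 9 15) ⟩
    24 * k             ≤⟨ *-monoʳ-≤ 24 (m≤m+n k 2) ⟩
    24 * (k + 2)       ≡⟨ *-assoc 4 6 (k + 2) ⟩
    4 * (6 * (k + 2))  ≤⟨ *-monoʳ-≤ 4 6[k+2]≤n ⟩
    4 * n              ≤⟨ 4n≤9a ⟩
    9 * a              ∎)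
    where open ≤-Reasoning

  a≤b : a ≤ b
  a≤b = ⌊n/2⌋≤⌈n/2⌉ (n ∸ h)

  size : Parity → ℕ
  size 0ℙ = a
  size 1ℙ = b

  k≤size : ∀ β → k ≤ size β
  k≤size 0ℙ = k≤a
  k≤size 1ℙ = ≤-trans k≤a a≤b

  open Construction size k 4≤k k≤size hiding (h; n)

  n≡ : a + (b + h) ≡ n
  n≡ = trans (sym (+-assoc a b h)) (trans (cong (_+ h) (⌊n/2⌋+⌈n/2⌉≡n (n ∸ h)))
         (m∸n+n≡m (≤-trans (m≤n*m h 12) 12h≤n)))

  bound : (n * n ∸ 2 * n) ^ 2 ≤ 16 * P
  bound = begin
    -- The periods are large enough for the stronger bound n⁴ ≤ 16 P.
    (n * n ∸ 2 * n) ^ 2          ≤⟨ ^-monoˡ-≤ 2 (m∸n≤m (n * n) (2 * n)) ⟩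
    (n * n) ^ 2                  ≡⟨ cong (n * n *_) (*-identityʳ (n * n)) ⟩
    n * n * (n * n)              ≤⟨ square-≤-product (n * n) V (≤-trans (m≤m+n 9 6) 15≤V) 16n²≤ ⟩
    16 * P                       ∎
    where
    open ≤-Reasoning
    regroup : ∀ x → 16 * (x * x) ≡ (4 * x) * (4 * x)
    regroup = solve-∀
    regroup′ : ∀ x y → (9 * x) * (9 * y) ≡ 81 * (x * y)
    regroup′ = solve-∀
    16n²≤ : 16 * (n * n) ≤ 81 * suc V
    16n²≤ = begin
      16 * (n * n)               ≡⟨ regroup n ⟩
      (4 * n) * (4 * n)          ≤⟨ *-mono-≤ 4n≤9a (≤-trans 4n≤9a (*-monoʳ-≤ 9 a≤b)) ⟩
      (9 * a) * (9 * b)          ≡⟨ regroup′ a b ⟩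
      81 * (a * b)               ≡⟨ cong (81 *_) suc-V ⟨
      81 * suc V                 ∎
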